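{- There is an absolute constant $\kappa_0>0$ such that for every positive integer $c$ and every positive integer $r$, the competitive ratio of $\mathrm{DLM}_c$ in the dynamic scenario (against all offline algorithms, on inputs whose requests have cardinality at most $r$) is at least $\kappa_0 r^2$. That is, this competitive ratio is $\Omega(r^2)$.
   Context: Online Min-Sum Set Cover (MSSC). Let $\mathcal U$ be a universe of $n$ elements. A permutation is a bijection $\pi:\mathcal U\to\{1,\dots,n\}$, where $\pi(z)$ is the list position of $z$. An input $\mathcal I$ consists of an initial permutation $\pi_0$ and a sequence of nonempty sets $R_1,\dots,R_m\subseteq\mathcal U$, each of cardinality at most $r$. In step $t$, an algorithm holding permutation $\pi_{t-1}$ pays the access cost $\min_{z\in R_t}\pi_{t-1}(z)$. It then picks $\pi_t$ and pays the reordering cost $d(\pi_{t-1},\pi_t)$, the minimum number of adjacent swaps turning $\pi_{t-1}$ into $\pi_t$. An online algorithm is $\rho$-competitive in the dynamic scenario if there is a constant $\xi$ such that for every input $\mathcal I$ and every offline algorithm $\mathrm{Off}$ starting from $\pi_0$, $\mathrm{Alg}(\mathcal I)\le \rho\,\mathrm{Off}(\mathcal I)+\xi$. The competitive ratio is the infimum of such $\rho$. Algorithm $\mathrm{DLM}_c$, where $c$ is a positive integer. Every element $z$ has a budget $b(z)$, initially $0$. The operation fetch$(z)$ moves $z$ to position 1 by $\pi(z)-1$ adjacent swaps, shifting the elements that preceded $z$ back by one, and then sets $b(z)\gets0$. On a request $R$, let $x\in R$ be the element of $R$ with the smallest current position and let $\ell=\pi(x)$. $\mathrm{DLM}_c$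 pays $\ell$, executes fetch$(x)$, and sets $b(y)\gets b(y)+\ell/c$ for every $y\in R\setminus\{x\}$. Then, while some element $z$ has $b(z)\ge\pi(z)$, it fetches such elements to the front. If $k>1$ elements satisfy $b(z)\ge\pi(z)$ simultaneously, $\mathrm{DLM}_c$ fetches them to the first $k$ positions preserving their relative order. -}

module Defs where

open import Data.Nat using (ℕ; zero; suc; _+_; _*_; _∸_; _≤?_)
open import Data.Fin using (Fin)
open import Data.Fin.Properties using () renaming (_≟_ to _≟ᶠ_)
open import Data.Fin.Subset using (Subset; Nonempty; ∣_∣)
open import Data.Fin.Subset.Properties using (_∈?_)
open import Data.List using (List; []; _∷_; _++_; filter; allFin)
open import Data.List.Relation.Unary.All using (All)
open import Data.List.Relation.Binary.Permutation.Propositional using (_↭_)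
open import Data.Maybe using (Maybe; just; nothing)
open import Data.Product using (_×_; _,_; ∃)
open import Data.Integer using (+_)
open import Data.Rational using (ℚ; _/_)
import Data.Rational as Q
open import Relation.Nullary using (yes; no; ¬?; Dec)

-- Conventions.
-- The universe U is Fin n.  A permutation π is represented by the list
-- of all elements in list order (head = position 1); it is a genuine
-- permutation iff the list is a rearrangement of allFin n.
-- A request R is a subset of Fin n (Data.Fin.Subset).

Config : ℕ → Set
Config n = List (Fin n)

IsPermutation : ∀ {n} → Config n → Set
IsPermutation {n} π = π ↭ allFin n

pos : ∀ {n} → Config n → Fin n → ℕ
pos []       z = 1
pos (y ∷ ys) z with y ≟ᶠ z
... | yes _ = 1
... | no  _ = suc (pos ys z)

firstIn : ∀ {n} → Config n → Subset n → Maybe (ℕ × Fin n)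
firstIn []       R = nothing
firstIn (y ∷ ys) R with y ∈? R
... | yes _ = just (1 , y)
... | no  _ with firstIn ys R
...   | nothing      = nothing
...   | just (p , z) = just (suc p , z)

accessCost : ∀ {n} → Config n → Subset n → ℕ
accessCost π R with firstIn π R
... | nothing      = 0
... | just (ℓ , _) = ℓ

-- Adjacent swaps (used for the offline algorithm).
-- swapAt i swaps the elements at (0-based) list indices i and i+1;
-- an out-of-range index is a no-op (such a step is still charged 1,
-- so it is never useful to an offline algorithm).

swapAt : ∀ {n} → ℕ → Config n → Config n
swapAt zero    (a ∷ b ∷ xs) = b ∷ a ∷ xs
swapAt (suc i) (a ∷ xs)     = a ∷ swapAt i xs
swapAt _       xs           = xs

applySwaps : ∀ {n} → List ℕ → Config n → Config n
applySwaps []       π = π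
applySwaps (i ∷ is) π = applySwaps is (swapAt i π)

length' : List ℕ → ℕ
length' []       = 0
length' (_ ∷ xs) = suc (length' xs)

-- An offline algorithm: in step t (t = 0,1,...) it performs the
-- sequence of adjacent swaps  off t  after serving the request; its
-- reordering cost is the number of swaps.  (Every choice of permutations
-- π_t with costs d(π_{t-1},π_t) is realised by minimal swap sequences,
-- and every swap sequence costs at least d, so quantifying over all
-- offline algorithms is the same.)
Offline : Set
Offline = ℕ → List ℕ

offCostFrom : ∀ {n} → ℕ → Offline → Config n → List (Subset n) → ℕ
offCostFrom t off π []       = 0
offCostFrom t off π (R ∷ Rs) =
  accessCost π R + length' (off t)
    + offCostFrom (suc t) off (applySwaps (off t) π) Rs

offCost : ∀ {n} → Offline → Config n → List (Subset n) → ℕ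
offCost off π₀ Rs = offCostFrom 0 off π₀ Rs

-- Algorithm DLM_c.
-- Budgets are stored scaled by c:  B z = c · b(z) ∈ ℕ, so that
-- "b(y) ← b(y) + ℓ/c" is "B y ← B y + ℓ" and "b(z) ≥ π(z)" is
-- "c · π(z) ≤ B z".

Budget : ℕ → Set
Budget n = Fin n → ℕ

-- fetch(x): move x to position 1 (cost π(x) - 1 swaps); budget reset
-- is done by the caller.
fetch : ∀ {n} → Fin n → Config n → Config n
fetch x π = x ∷ filter (λ y → ¬? (y ≟ᶠ x)) π

afterAccess : ∀ {n} → Subset n → Fin n → ℕ → Budget n → Budget n
afterAccess R x ℓ B y with y ≟ᶠ x
... | yes _ = 0
... | no  _ with y ∈? R
...   | yes _ = B y + ℓ
...   | no  _ = B y

eligible? : ∀ {n} (c : ℕ) (π : Config n) (B : Budget n) → (z : Fin n) → Dec (c * pos π z Data.Nat.≤ B z)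
eligible? c π B z = (c * pos π z) ≤? B z

-- Cost of moving the eligible elements z_1,...,z_k (in their current
-- order) to positions 1..k preserving relative order: the i-th one,
-- at position p, makes p - i adjacent swaps.
-- Arguments: p = position of the head of the list, k = #eligible seen.
groupCost : ∀ {n} → ℕ → Config n → Budget n → ℕ → ℕ → Config n → ℕ
groupCost c π B p k []       = 0
groupCost c π B p k (z ∷ zs) with eligible? c π B z
... | yes _ = (p ∸ suc k) + groupCost c π B (suc p) (suc k) zs
... | no  _ = groupCost c π B (suc p) k zs

round : ∀ {n} → ℕ → Config n → Budget n → Maybe (Config n × Budget n × ℕ)
round c π B with filter (eligible? c π B) π
... | [] = nothing
... | S@(_ ∷ _) =
  just ( S ++ filter (λ z → ¬? (eligible? c π B z)) π
       , (λ z → resetIf z)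
       , groupCost c π B 1 0 π )
  where
  resetIf : Fin _ → ℕ
  resetIf z with eligible? c π B z
  ... | yes _ = 0
  ... | no  _ = B z

-- The while loop, run with fuel (fuel ≥ 1 suffices: after one round no
-- element is eligible, since fetched elements have budget 0 and all other
-- elements only move back).
whileLoop : ∀ {n} → ℕ → ℕ → Config n → Budget n → Config n × Budget n × ℕ
whileLoop zero     c π B = π , B , 0
whileLoop (suc f) c π B with round c π B
... | nothing            = π , B , 0
... | just (π' , B' , k) with whileLoop f c π' B'
...   | (π'' , B'' , k') = π'' , B'' , k + k'

dlmStep : ∀ {n} → ℕ → Subset n → Config n × Budget n → Config n × Budget n × ℕ
dlmStep {n} c R (π , B) with firstIn π R
... | nothing      = π , B , 0
... | just (ℓ , x) with whileLoop (suc n) c (fetch x π) (afterAccess R x ℓ B)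
...   | (π' , B' , k) = π' , B' , ℓ + (ℓ ∸ 1) + k

dlmRun : ∀ {n} → ℕ → Config n × Budget n → List (Subset n) → ℕ
dlmRun c s []       = 0
dlmRun c s (R ∷ Rs) with dlmStep c R s
... | (π' , B' , k) = k + dlmRun c (π' , B') Rs

dlmCost : ∀ {n} → ℕ → Config n → List (Subset n) → ℕ
dlmCost c π₀ Rs = dlmRun c (π₀ , (λ _ → 0)) Rs

toℚ : ℕ → ℚ
toℚ m = (+ m) / 1

ValidRequest : ∀ {n} → ℕ → Subset n → Set
ValidRequest r R = Nonempty R × ∣ R ∣ Data.Nat.≤ r

-- DLM_c is ρ-competitive in the dynamic scenario on universe Fin n,
-- for inputs whose requests have cardinality at most r.
-- (The additive constant ξ may be taken in ℕ w.l.o.g.)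
DLMCompetitiveOn : ℕ → ℕ → ℕ → ℚ → Set
DLMCompetitiveOn n c r ρ =
  ∃ λ (ξ : ℕ) →
    (π₀ : Config n) → IsPermutation π₀ →
    (Rs : List (Subset n)) → All (ValidRequest r) Rs →
    (off : Offline) →
    toℚ (dlmCost c π₀ Rs) Q.≤ ρ Q.* toℚ (offCost off π₀ Rs) Q.+ toℚ ξ

{-# OPTIONS --safe #-}

-- With s = c + r, the adversary arranges the list as W₀ X₁ W₁ … X_c W_c, where |W_i| = r - 1 and
-- |X_i| = c + 1, so that n = ℓ + (r - 1) for ℓ = c s.  A round consists of c + 1 requests {x} ∪ W_c,
-- where x is the current last element of the part in front of W_c; all of them cost DLM_c exactly ℓ.
-- The budgets of W_c stay below their positions until the last of these requests, when they all
-- reach (c + 1) ℓ ≥ c n and W_c is fetched as a group.  So a round costs at least s ℓ, it ends with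
-- all budgets 0 again, and the list becomes W_c X_c W₀ X₁ … W_{c-1}, which has the initial shape.
-- The offline algorithm keeps the first elements of the c + 1 blocks W_i at the front, in the order in
-- which they are going to be needed; it pays 1 per request and c swaps per round to rotate them,
-- 2 c + 1 in total.  The ratio is at least c s² / (2 c + 1) ≥ r² / 3.
-- This needs r ≥ 2, so that W_i is nonempty; for r = 1 a universe with one element gives ratio 1.
module Submission where

open import Defs
open import Data.Nat using (ℕ; zero; suc; _+_; _*_; _∸_; _≤_; _<_; z≤n; s≤s)
open import Data.Product using (Σ; _×_; _,_; ∃; ∃₂; proj₁; proj₂)
open import Data.Rational using (ℚ; 0ℚ; 1ℚ; Positive; positive)
import Data.Rational as Q

open import Data.Fin using (Fin)
open import Data.Fin.Properties using () renaming (_≟_ to _≟ᶠ_)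
open import Data.Fin.Subset using (Subset; ⁅_⁆; _∪_; ⋃; ∣_∣; inside; outside)
  renaming (_∈_ to _∈ˢ_; _∉_ to _∉ˢ_)
open import Data.Fin.Subset.Properties
  using (_∈?_; x∈⁅x⁆; x∈⁅y⁆⇒x≡y; x∈p∪q⁺; x∈p∪q⁻; ∉⊥; ∣⁅x⁆∣≡1; ∣⊥∣≡0)
open import Data.Integer as ℤ using (+≤+; +<+)
import Data.Integer.Properties as ℤ
  using (*-identityʳ; *-monoʳ-≤-nonNeg; <-≤-trans; ≤-<-trans; ≤-refl; pos-*)
open import Data.List as List
  using (List; []; _∷_; [_]; _++_; filter; map; length; replicate; reverse; _ʳ++_)
open import Data.List.Properties
  using (filter-++; filter-all; filter-none; filter-reject; ++-identityʳ; ++-assoc; ʳ++-defn;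
         length-++; length-reverse; length-ʳ++; map-++)
open import Data.List.Membership.Propositional using (_∈_; _∉_)
open import Data.List.Membership.Propositional.Properties using (∈-++⁺ʳ)
open import Data.List.Relation.Binary.Permutation.Propositional as Perm
  using (_↭_; ↭-sym; ↭-refl; ↭⇒↭ₛ)
open import Data.List.Relation.Binary.Permutation.Propositional.Properties
  using (shift; ++-comm; ++⁺; ++⁺ˡ; ++⁺ʳ; ++↭ʳ++)
import Data.List.Relation.Binary.Permutation.Setoid.Properties as Permutationₛ
open import Data.List.Relation.Unary.All as All using (All; []; _∷_)
import Data.List.Relation.Unary.All.Properties as All
open import Data.List.Relation.Unary.Any using (here; there; any?)
open import Data.List.Relation.Unary.Unique.Propositional using (Unique; []; _∷_)
open import Data.List.Relation.Unary.Unique.Propositional.Properties using (allFin⁺)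
open import Data.Maybe using (just; nothing)
open import Data.Nat.Properties
  using (*-distribˡ-+; *-mono-≤; *-monoʳ-≤; *-monoˡ-≤; *-suc; +-assoc; +-comm; +-identityʳ; +-mono-≤;
         +-monoʳ-≤; +-monoˡ-≤; +-suc; <-≤-trans; <⇒≱; m+n∸n≡m; m≤m*n; m≤m+n; m≤n+m; n≤1+n;
         suc-injective; ≤-refl; ≤-reflexive; ≤-trans; module ≤-Reasoning)
open import Data.Nat.Tactic.RingSolver using (solve-∀)
import Data.Rational.Properties as Q
  using (*-assoc; *-cancelʳ-≤-pos; *-identityʳ; *-identityˡ; *-inverseˡ; *-monoˡ-<-pos; *-monoˡ-≤-nonNeg;
         +-identityˡ; +-monoˡ-≤; <-irrefl; normalize-pos; positive⁻¹; pos⇒nonZero; toℚᵘ-cancel-<;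
         toℚᵘ-cancel-≤; toℚᵘ-fromℚᵘ; toℚᵘ-homo-*; toℚᵘ-homo-+; toℚᵘ-injective; ≤-trans; ≮⇒≥;
         module ≤-Reasoning)
open import Data.Rational.Solver using (module +-*-Solver)
open import Data.Rational.Unnormalised as ℚᵘ using (mkℚᵘ; *≡*; *≤*; *<*)
import Data.Rational.Unnormalised.Properties as ℚᵘ
  using (*-cong; +-cong; module ≃-Reasoning; module ≤-Reasoning)
open import Data.Sum using (_⊎_; inj₁; inj₂)
open import Data.Vec as Vec using (Vec; []; _∷_; toList; head; _∷ʳ_; splitAt)
open import Data.Vec.Properties using (length-toList; toList-++)
open import Function using (_∘_; id)
open import Relation.Binary.PropositionalEquality
  using (_≡_; refl; sym; trans; cong; cong₂; subst; subst₂; setoid; module ≡-Reasoning)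
open import Relation.Nullary using (¬_; Dec; yes; no; ¬?; contradiction)

private
  variable
    n : ℕ

-- Requests given by lists of elements.

setOf : List (Fin n) → Subset n
setOf xs = ⋃ (map ⁅_⁆ xs)

∈-setOf⁺ : ∀ {x : Fin n} {xs} → x ∈ xs → x ∈ˢ setOf xs
∈-setOf⁺ (here refl)  = x∈p∪q⁺ (inj₁ (x∈⁅x⁆ _))
∈-setOf⁺ (there x∈xs) = x∈p∪q⁺ (inj₂ (∈-setOf⁺ x∈xs))

∈-setOf⁻ : ∀ {x : Fin n} xs → x ∈ˢ setOf xs → x ∈ xs
∈-setOf⁻ []       x∈ = contradiction x∈ ∉⊥
∈-setOf⁻ (y ∷ xs) x∈ with x∈p∪q⁻ ⁅ y ⁆ _ x∈
... | inj₁ p = here (x∈⁅y⁆⇒x≡y y p)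
... | inj₂ q = there (∈-setOf⁻ xs q)

∣p∪q∣≤∣p∣+∣q∣ : ∀ (p q : Subset n) → ∣ p ∪ q ∣ ≤ ∣ p ∣ + ∣ q ∣
∣p∪q∣≤∣p∣+∣q∣ []            []            = z≤n
∣p∪q∣≤∣p∣+∣q∣ (inside ∷ p)  (inside ∷ q)  =
  s≤s (≤-trans (∣p∪q∣≤∣p∣+∣q∣ p q) (+-monoʳ-≤ ∣ p ∣ (n≤1+n ∣ q ∣)))
∣p∪q∣≤∣p∣+∣q∣ (inside ∷ p)  (outside ∷ q) = s≤s (∣p∪q∣≤∣p∣+∣q∣ p q)
∣p∪q∣≤∣p∣+∣q∣ (outside ∷ p) (inside ∷ q)  =
  ≤-trans (s≤s (∣p∪q∣≤∣p∣+∣q∣ p q)) (≤-reflexive (sym (+-suc ∣ p ∣ ∣ q ∣)))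
∣p∪q∣≤∣p∣+∣q∣ (outside ∷ p) (outside ∷ q) = ∣p∪q∣≤∣p∣+∣q∣ p q

∣setOf∣≤length : ∀ (xs : List (Fin n)) → ∣ setOf xs ∣ ≤ length xs
∣setOf∣≤length {n} []   = ≤-reflexive (∣⊥∣≡0 n)
∣setOf∣≤length (x ∷ xs) = ≤-trans (∣p∪q∣≤∣p∣+∣q∣ ⁅ x ⁆ (setOf xs))
  (+-mono-≤ (≤-reflexive (∣⁅x⁆∣≡1 x)) (∣setOf∣≤length xs))

setOf-valid : ∀ {r} (x : Fin n) xs → length (x ∷ xs) ≤ r → ValidRequest r (setOf (x ∷ xs))
setOf-valid x xs len≤r =
  (x , ∈-setOf⁺ {xs = x ∷ xs} (here refl)) , ≤-trans (∣setOf∣≤length (x ∷ xs)) len≤r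

-- Positions and accesses in lists without repetition.

Unique-resp-↭ : ∀ {xs ys : List (Fin n)} → xs ↭ ys → Unique xs → Unique ys
Unique-resp-↭ = Permutationₛ.Unique-resp-↭ (setoid _) ∘ ↭⇒↭ₛ

Unique-++⁻ : ∀ {P Q : List (Fin n)} {z} → Unique (P ++ Q) → z ∈ P → z ∉ Q
Unique-++⁻ {P = _ ∷ P} (x∉ ∷ _) (here refl) z∈Q = All.lookup x∉ (∈-++⁺ʳ P z∈Q) refl
Unique-++⁻ {P = _ ∷ _} (_ ∷ u)  (there z∈P) z∈Q = Unique-++⁻ u z∈P z∈Q

Unique-head : ∀ {x : Fin n} {xs} → Unique (x ∷ xs) → x ∉ xs
Unique-head (x∉ ∷ _) x∈ = All.lookup x∉ x∈ refl

pos-∉ : ∀ (P : Config n) {T z} → z ∉ P → length P < pos (P ++ T) z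
pos-∉ [] {[]}    {z} _ = s≤s z≤n
pos-∉ [] {y ∷ T} {z} _ with y ≟ᶠ z
... | yes _ = s≤s z≤n
... | no  _ = s≤s z≤n
pos-∉ (y ∷ P) {z = z} z∉ with y ≟ᶠ z
... | yes y≡z = contradiction (here (sym y≡z)) z∉
... | no  _   = s≤s (pos-∉ P (z∉ ∘ there))

pos>0 : ∀ (π : Config n) z → 0 < pos π z
pos>0 π z = pos-∉ [] {π} λ ()

pos-∈ : ∀ {π : Config n} {z} → z ∈ π → pos π z ≤ length π
pos-∈ {π = y ∷ π} {z} z∈ with y ≟ᶠ z | z∈
... | yes _  | _          = s≤s z≤n
... | no y≢z | here z≡y   = contradiction (sym z≡y) y≢z
... | no _   | there z∈π  = s≤s (pos-∈ z∈π)

firstIn-++ : ∀ {P : Config n} {x T R} → All (_∉ˢ R) P → x ∈ˢ R →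
             firstIn (P ++ x ∷ T) R ≡ just (suc (length P) , x)
firstIn-++ {x = x} {R = R} [] x∈R with x ∈? R
... | yes _  = refl
... | no x∉R = contradiction x∈R x∉R
firstIn-++ {P = y ∷ P} {x} {T} {R} (y∉R ∷ P∉R) x∈R with y ∈? R
... | yes y∈R = contradiction y∈R y∉R
... | no _ rewrite firstIn-++ {T = T} P∉R x∈R = refl

accessCost-∷ : ∀ {x : Fin n} {T R} → x ∈ˢ R → accessCost (x ∷ T) R ≡ 1
accessCost-∷ {T = T} x∈R rewrite firstIn-++ {T = T} [] x∈R = refl

fetch-++ : ∀ (P : Config n) {x T} → x ∉ P ++ T → fetch x (P ++ x ∷ T) ≡ x ∷ P ++ T
fetch-++ P {x} {T} x∉ = cong (x ∷_) (begin
  filter ≢x? (P ++ x ∷ T)              ≡⟨ filter-++ ≢x? P (x ∷ T) ⟩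
  filter ≢x? P ++ filter ≢x? (x ∷ T)   ≡⟨ cong (filter ≢x? P ++_) (filter-reject ≢x? (λ x≢x → x≢x refl)) ⟩
  filter ≢x? P ++ filter ≢x? T         ≡⟨ filter-++ ≢x? P T ⟨
  filter ≢x? (P ++ T)                  ≡⟨ filter-all ≢x? (All.tabulate λ where z∈ refl → x∉ z∈) ⟩
  P ++ T ∎)
  where
  open ≡-Reasoning
  ≢x? = λ y → ¬? (y ≟ᶠ x)

-- Single steps of DLM and its while loop.

-- The rest of `dlmStep` once the accessed element and its position are known. The list after the
-- fetch is a separate argument, so that a congruence can put it in closed form.
settle : ℕ → Subset n → Budget n → ℕ → Fin n → Config n → Config n × Budget n × ℕ
settle {n} c R B ℓ x π =
  let π' , B' , k = whileLoop (suc n) c π (afterAccess R x ℓ B) in π' , B' , ℓ + (ℓ ∸ 1) + k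

dlmStep-just : ∀ c {π : Config n} {R B ℓ x} → firstIn π R ≡ just (ℓ , x) →
  dlmStep c R (π , B) ≡ settle c R B ℓ x (fetch x π)
dlmStep-just c eq rewrite eq = refl

dlmStep-++ : ∀ c {P : Config n} {x T R B} → All (_∉ˢ R) P → x ∈ˢ R → x ∉ P ++ T →
  dlmStep c R (P ++ x ∷ T , B) ≡ settle c R B (suc (length P)) x (x ∷ P ++ T)
dlmStep-++ c {P} {T = T} P∉R x∈R x∉ =
  trans (dlmStep-just c (firstIn-++ {T = T} P∉R x∈R)) (cong (settle c _ _ _ _) (fetch-++ P x∉))

round-[] : ∀ c (π : Config n) B → filter (eligible? c π B) π ≡ [] → round c π B ≡ nothing
round-[] c π B none rewrite none = refl

-- The new budget is a function local to `round`, so it is described by its values: eligible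
-- elements are reset, the others keep a budget that was already 0.
round-reset : ∀ c (π : Config n) B {π' B' k} → round c π B ≡ just (π' , B' , k) →
  ∀ y → c * pos π y ≤ B y ⊎ B y ≡ 0 → B' y ≡ 0
round-reset c π B eq y el⊎0 with filter (eligible? c π B) π | eq
... | _ ∷ _ | refl with eligible? c π B y | el⊎0
...   | yes _  | _         = refl
...   | no ¬el | inj₁ el   = contradiction el ¬el
...   | no _   | inj₂ By≡0 = By≡0

round-∷ : ∀ c (π : Config n) B {z S} → filter (eligible? c π B) π ≡ z ∷ S →
  ∃ λ B' → round c π B ≡ just ((z ∷ S) ++ filter (λ y → ¬? (eligible? c π B y)) π , B' , groupCost c π B 1 0 π)
round-∷ c π B eq with filter (eligible? c π B) π | eq
... | _ | refl = _ , refl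

whileLoop-quiet : ∀ f c (π : Config n) B → (∀ z → B z < c * pos π z) → whileLoop f c π B ≡ (π , B , 0)
whileLoop-quiet zero    c π B _     = refl
whileLoop-quiet (suc f) c π B below
  rewrite round-[] c π B (filter-none (eligible? c π B)
            (All.tabulate {xs = π} λ {z} _ → <⇒≱ (below z))) = refl

groupCost-none : ∀ {c} {π : Config n} {B} p k {P} T → All (λ z → ¬ c * pos π z ≤ B z) P →
  groupCost c π B p k (P ++ T) ≡ groupCost c π B (length P + p) k T
groupCost-none p k T [] = refl
groupCost-none {c = c} {π} {B} p k {z ∷ P} T (¬el ∷ ¬els) with eligible? c π B z
... | yes el = contradiction el ¬el
... | no _   = trans (groupCost-none (suc p) k T ¬els)
                     (cong (λ q → groupCost c π B q k T) (+-suc (length P) p))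

-- Along a contiguous run of eligible elements `p` and `k` grow together, so all of them travel the
-- same distance.
groupCost-all : ∀ {c} {π : Config n} {B} p k {W} → All (λ z → c * pos π z ≤ B z) W →
  groupCost c π B p k W ≡ length W * (p ∸ suc k)
groupCost-all p k [] = refl
groupCost-all {c = c} {π} {B} p k {z ∷ W} (el ∷ els) with eligible? c π B z
... | yes _  = cong ((p ∸ suc k) +_) (groupCost-all (suc p) (suc k) els)
... | no ¬el = contradiction el ¬el

filter-++-suffix : ∀ {A : Set} {P : A → Set} (P? : ∀ x → Dec (P x)) {xs ys} →
  All (¬_ ∘ P) xs → All P ys → filter P? (xs ++ ys) ≡ ys
filter-++-suffix P? {xs} {ys} none all = trans (filter-++ P? xs ys)
  (cong₂ _++_ (filter-none P? none) (filter-all P? all))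

filter-++-prefix : ∀ {A : Set} {P : A → Set} (P? : ∀ x → Dec (P x)) {xs ys} →
  All P xs → All (¬_ ∘ P) ys → filter P? (xs ++ ys) ≡ xs
filter-++-prefix P? {xs} {ys} all none = trans (filter-++ P? xs ys)
  (trans (cong₂ _++_ (filter-all P? all) (filter-none P? none)) (++-identityʳ xs))

zero-quiet : ∀ {c} → 1 ≤ c → ∀ (π : Config n) {B : Budget n} → (∀ z → B z ≡ 0) →
             ∀ z → B z < c * pos π z
zero-quiet 1≤c π B≡0 z rewrite B≡0 z = *-mono-≤ 1≤c (pos>0 π z)

-- The eligible elements are exactly a suffix, which the first iteration moves to the front. It
-- leaves all budgets 0, and positions are positive, so the loop then stops.
whileLoop-fetch : ∀ f {c} {P : Config n} {w W B} → 1 ≤ c →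
  let π = P ++ w ∷ W in
  All (λ z → ¬ c * pos π z ≤ B z) P →
  All (λ z → c * pos π z ≤ B z) (w ∷ W) →
  (∀ z → c * pos π z ≤ B z ⊎ B z ≡ 0) →
  ∃ λ B' → whileLoop (suc f) c π B ≡ (w ∷ W ++ P , B' , suc (length W) * length P)
         × (∀ z → B' z ≡ 0)
whileLoop-fetch f {c} {P} {w} {W} {B} 1≤c none all off
  with B' , eq ← round-∷ c (P ++ w ∷ W) B
         (filter-++-suffix (eligible? c (P ++ w ∷ W) B) none all)
  with eq' ← trans eq (cong₂ (λ Q k → just (w ∷ W ++ Q , B' , k))
         (filter-++-prefix (λ y → ¬? (eligible? c (P ++ w ∷ W) B y)) none
            (All.map (λ el ¬el → ¬el el) all))
         -- The suffix begins at position `length P + 1`, so each of its elements crosses exactly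
         -- `P`.
         (trans (groupCost-none 1 0 (w ∷ W) none)
           (trans (groupCost-all {c = c} {P ++ w ∷ W} (length P + 1) 0 all)
             (cong (suc (length W) *_) (m+n∸n≡m (length P) 1)))))
  with B'≡0 ← (λ z → round-reset c _ B eq' z (off z))
  rewrite eq'
        | whileLoop-quiet f c (w ∷ W ++ P) B' (zero-quiet 1≤c _ B'≡0)
        | +-identityʳ (suc (length W) * length P) = B' , refl , B'≡0

-- Budgets and cost of one access within a round.

-- The invariant of a round: its requests share `W` and differ only in the accessed element, whose
-- budget is reset, so one number describes all budgets.
Charged : List (Fin n) → ℕ → Budget n → Set
Charged W b B = (∀ z → z ∈ W → B z ≡ b) × (∀ z → z ∉ W → B z ≡ 0)

zero-charged : ∀ {W : List (Fin n)} {B} → (∀ z → B z ≡ 0) → Charged W 0 B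
zero-charged B≡0 = (λ z _ → B≡0 z) , (λ z _ → B≡0 z)

afterAccess-charged : ∀ {W : List (Fin n)} {x ℓ b B} → x ∉ W → Charged W b B →
  Charged W (b + ℓ) (afterAccess (setOf (x ∷ W)) x ℓ B)
afterAccess-charged {W = W} {x} {ℓ} {b} {B} x∉W (B≡b , B≡0) = on , off
  where
  on : ∀ z → z ∈ W → afterAccess (setOf (x ∷ W)) x ℓ B z ≡ b + ℓ
  on z z∈W with z ≟ᶠ x
  ... | yes refl = contradiction z∈W x∉W
  ... | no _ with z ∈? setOf (x ∷ W)
  ...   | yes _  = cong (_+ ℓ) (B≡b z z∈W)
  ...   | no z∉R = contradiction (∈-setOf⁺ {xs = x ∷ W} (there z∈W)) z∉R
  off : ∀ z → z ∉ W → afterAccess (setOf (x ∷ W)) x ℓ B z ≡ 0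
  off z z∉W with z ≟ᶠ x
  ... | yes _ = refl
  ... | no z≢x with z ∈? setOf (x ∷ W)
  ...   | no _    = B≡0 z z∉W
  ...   | yes z∈R with ∈-setOf⁻ (x ∷ W) z∈R
  ...     | here z≡x  = contradiction z≡x z≢x
  ...     | there z∈W = contradiction z∈W z∉W

dlmRun-step : ∀ {c R} {s : Config n × Budget n} {π' B' k j K} Rs →
  dlmStep c R s ≡ (π' , B' , k) → j ≤ k → K ≤ dlmRun c (π' , B') Rs → j + K ≤ dlmRun c s (R ∷ Rs)
dlmRun-step _ eq j≤k K≤ rewrite eq = +-mono-≤ j≤k K≤

-- Fetching the head changes nothing in the list. The continuation covers every pointwise zero
-- budget, since the new budget function is equal to the old one only pointwise.
access-head : ∀ {c} {π : Config n} {x T B K} Rs → 1 ≤ c → π ≡ x ∷ T → Unique π → (∀ z → B z ≡ 0) →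
  (∀ B' → (∀ z → B' z ≡ 0) → K ≤ dlmRun c (π , B') Rs) →
  suc K ≤ dlmRun c (π , B) (setOf (x ∷ []) ∷ Rs)
access-head {n} {c} {x = x} {T} {B} Rs 1≤c refl U B≡0 next = dlmRun-step Rs
  (trans (dlmStep-++ c [] (∈-setOf⁺ {xs = x ∷ []} (here refl)) (Unique-head U))
    (cong (λ (π , B , k) → π , B , 1 + k)
      (whileLoop-quiet (suc n) c (x ∷ T) _ (zero-quiet 1≤c (x ∷ T) B'≡0))))
  (s≤s z≤n) (next _ B'≡0)
  where
  B'≡0 : ∀ z → afterAccess (setOf (x ∷ [])) x 1 B z ≡ 0
  B'≡0 z = proj₂ (afterAccess-charged {W = []} {b = 0} (λ ()) (zero-charged B≡0)) z λ ()

Unique-shift : ∀ {P W : List (Fin n)} {x} → Unique (P ++ x ∷ W) → Unique (x ∷ P ++ W)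
Unique-shift {P = P} {W} {x} = Unique-resp-↭ (shift x P W)

dlmStep-request : ∀ c {P W : List (Fin n)} {x B} → Unique (P ++ x ∷ W) →
  dlmStep c (setOf (x ∷ W)) (P ++ x ∷ W , B) ≡ settle c (setOf (x ∷ W)) B (suc (length P)) x (x ∷ P ++ W)
dlmStep-request c {P} {W} {x} U = dlmStep-++ c
  (All.tabulate λ z∈P z∈R → Unique-++⁻ U z∈P (∈-setOf⁻ (x ∷ W) z∈R))
  (∈-setOf⁺ {xs = x ∷ W} (here refl))
  (Unique-head (Unique-shift U))

module _ {n c} {P W : List (Fin n)} {x : Fin n} {B b} (1≤c : 1 ≤ c)
         (U : Unique (P ++ x ∷ W)) (ch : Charged W b B) where

  private
    ℓ = suc (length P)
    π : Config n
    π = x ∷ P ++ W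
    B' : Budget n
    B' = afterAccess (setOf (x ∷ W)) x ℓ B

    charged : Charged W (b + ℓ) B'
    charged = afterAccess-charged (Unique-head (Unique-shift U) ∘ ∈-++⁺ʳ P) ch

    disjoint : ∀ {z} → z ∈ W → z ∉ x ∷ P
    disjoint z∈W z∈ = Unique-++⁻ (Unique-shift {P = P} U) z∈ z∈W

    -- After the fetch, `x ∷ P` occupies the first `ℓ` positions.
    far : ∀ {z} → z ∈ W → suc ℓ ≤ pos π z
    far z∈W = pos-∉ (x ∷ P) {W} (disjoint z∈W)

    idle : ∀ {z} → z ∉ W → B' z < c * pos π z
    idle {z} z∉W rewrite proj₂ charged z z∉W = *-mono-≤ 1≤c (pos>0 π z)

  -- Elements of `W` are at position `ℓ + 1` or later, and all other budgets are 0, so nothing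
  -- becomes eligible. Of the true cost `2ℓ - 1` only the access cost is counted.
  access-quiet : ∀ {K} Rs → b + ℓ < c * suc ℓ →
    (∀ B' → Charged W (b + ℓ) B' → K ≤ dlmRun c (π , B') Rs) →
    ℓ + K ≤ dlmRun c (P ++ x ∷ W , B) (setOf (x ∷ W) ∷ Rs)
  access-quiet Rs small next = dlmRun-step Rs
    (trans (dlmStep-request c U) (cong (λ (π , B , k) → π , B , ℓ + length P + k)
      (whileLoop-quiet (suc n) c π B' below)))
    (≤-trans (m≤m+n ℓ (length P)) (m≤m+n _ 0)) (next _ charged)
    where
    below : ∀ z → B' z < c * pos π z
    below z with any? (z ≟ᶠ_) W
    ... | no z∉W  = idle z∉W
    ... | yes z∈W rewrite proj₁ charged z z∈W = <-≤-trans small (*-monoʳ-≤ c (far z∈W))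

  -- No position exceeds the length of the list, so all of `W` is eligible, and each of its elements
  -- crosses the `ℓ` elements of `x ∷ P`.
  access-fetch : ∀ {w V K} Rs → W ≡ w ∷ V → c * length π ≤ b + ℓ →
    (∀ B' → (∀ z → B' z ≡ 0) → K ≤ dlmRun c (W ++ x ∷ P , B') Rs) →
    ℓ + length W * ℓ + K ≤ dlmRun c (P ++ x ∷ W , B) (setOf (x ∷ W) ∷ Rs)
  access-fetch {w} {V} Rs refl large next
    = let B″ , eq , B″≡0 = whileLoop-fetch n {c} {x ∷ P} {w} {V} {B'} 1≤c
           (All.tabulate λ z∈ → <⇒≱ (idle λ z∈W → disjoint z∈W z∈))
           (All.tabulate full) reset
      in dlmRun-step Rs
        (trans (dlmStep-request c U) (cong (λ (π , B , k) → π , B , ℓ + length P + k) eq))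
        (+-monoˡ-≤ (length W * ℓ) (m≤m+n ℓ (length P))) (next B″ B″≡0)
    where
    full : ∀ {z} → z ∈ W → c * pos π z ≤ B' z
    full {z} z∈W rewrite proj₁ charged z z∈W =
      ≤-trans (*-monoʳ-≤ c (pos-∈ (∈-++⁺ʳ (x ∷ P) z∈W))) large
    reset : ∀ z → c * pos π z ≤ B' z ⊎ B' z ≡ 0
    reset z with any? (z ≟ᶠ_) W
    ... | yes z∈W = inj₁ (full z∈W)
    ... | no z∉W  = inj₂ (proj₂ charged z z∉W)

-- Offline strategies and sequences of adjacent swaps.

-- Each request is paired with the offline swaps performed after it, so that the input and the
-- offline algorithm are built together.
Plan : ℕ → Set
Plan n = List (Subset n × List ℕ)

requests : Plan n → List (Subset n)
requests = map proj₁

follow : Plan n → Offline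
follow []             _       = []
follow ((_ , is) ∷ _) zero    = is
follow (_ ∷ ps)       (suc t) = follow ps t

planCost : Config n → Plan n → ℕ
planCost π []              = 0
planCost π ((R , is) ∷ ps) = accessCost π R + length' is + planCost (applySwaps is π) ps

-- The clock `t` advances while the plan is consumed, so the induction asks for agreement with the
-- remaining plan from time `t` on.
offCostFrom-follow : ∀ t off (π : Config n) ps → (∀ i → off (t + i) ≡ follow ps i) →
  offCostFrom t off π (requests ps) ≡ planCost π ps
offCostFrom-follow t off π []              eq = refl
offCostFrom-follow t off π ((R , is) ∷ ps) eq
  rewrite trans (cong off (sym (+-identityʳ t))) (eq 0) =
  cong (accessCost π R + length' is +_)
    (offCostFrom-follow (suc t) off (applySwaps is π) ps
      λ i → trans (cong off (sym (+-suc t i))) (eq (suc i)))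

applySwaps-++ : ∀ is js (π : Config n) → applySwaps (is ++ js) π ≡ applySwaps js (applySwaps is π)
applySwaps-++ []       js π = refl
applySwaps-++ (i ∷ is) js π = applySwaps-++ is js (swapAt i π)

applySwaps-suc : ∀ is x (π : Config n) → applySwaps (map suc is) (x ∷ π) ≡ x ∷ applySwaps is π
applySwaps-suc []       x π = refl
applySwaps-suc (i ∷ is) x π = applySwaps-suc is x (swapAt i π)

-- A `swap` in the derivation is one adjacent swap at the head, and every element passed over shifts
-- the indices by one. This serves the initial rearrangement, whose cost is a constant independent
-- of the number of rounds.
↭⇒applySwaps : ∀ {π σ : Config n} → π ↭ σ → ∃ λ is → applySwaps is π ≡ σ
↭⇒applySwaps Perm.refl = [] , refl
↭⇒applySwaps (Perm.prep x p) with is , refl ← ↭⇒applySwaps p = map suc is , applySwaps-suc is x _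
↭⇒applySwaps (Perm.swap x y p) with is , refl ← ↭⇒applySwaps p =
  0 ∷ map suc (map suc is) ,
  trans (applySwaps-suc (map suc is) y _) (cong (y ∷_) (applySwaps-suc is x _))
↭⇒applySwaps (Perm.trans p q) with is , refl ← ↭⇒applySwaps p | js , refl ← ↭⇒applySwaps q =
  is ++ js , applySwaps-++ is js _

-- Moves the head of the list behind the m elements that follow it.
sink : ℕ → List ℕ
sink zero    = []
sink (suc m) = 0 ∷ map suc (sink m)

length'-sink : ∀ m → length' (sink m) ≡ m
length'-sink zero    = refl
length'-sink (suc m) = cong suc (trans (length'-map (sink m)) (length'-sink m))
  where
  length'-map : ∀ is → length' (map suc is) ≡ length' is
  length'-map []       = refl
  length'-map (_ ∷ is) = cong suc (length'-map is)

applySwaps-sink : ∀ y (ys T : Config n) → applySwaps (sink (length ys)) (y ∷ ys ++ T) ≡ ys ++ y ∷ T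
applySwaps-sink y []       T = refl
applySwaps-sink y (z ∷ ys) T = trans (applySwaps-suc (sink (length ys)) z _)
  (cong (z ∷_) (applySwaps-sink y ys T))

-- One round; the offline algorithm reorders only after its last request.
stretch : List (Fin n) → List (Fin n) → ℕ → Plan n
stretch []            W m = []
stretch (x ∷ [])      W m = (setOf (x ∷ W) , sink m) ∷ []
stretch (x ∷ x' ∷ xs) W m = (setOf (x ∷ W) , []) ∷ stretch (x' ∷ xs) W m

-- Every request of the round contains `y`, which stays in front until the final reordering, so each
-- access costs 1.
planCost-stretch : ∀ x xs {W y} m (T : Config n) ps → y ∈ W →
  planCost (y ∷ T) (stretch (x ∷ xs) W m ++ ps) ≡
  length (x ∷ xs) + m + planCost (applySwaps (sink m) (y ∷ T)) ps
planCost-stretch x [] {W} {y} m T ps y∈W =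
  cong (_+ planCost (applySwaps (sink m) (y ∷ T)) ps)
    (cong₂ _+_ (accessCost-∷ {T = T} (∈-setOf⁺ {xs = x ∷ W} (there y∈W))) (length'-sink m))
planCost-stretch x (x' ∷ xs) {W} m T ps y∈W =
  cong₂ _+_ (cong (_+ 0) (accessCost-∷ {T = T} (∈-setOf⁺ {xs = x ∷ W} (there y∈W))))
            (planCost-stretch x' xs m T ps y∈W)

stretch-valid : ∀ {r} (xs : List (Fin n)) W m → suc (length W) ≤ r →
  All (ValidRequest r ∘ proj₁) (stretch xs W m)
stretch-valid []            W m len = []
stretch-valid (x ∷ [])      W m len = setOf-valid x W len ∷ []
stretch-valid (x ∷ x' ∷ xs) W m len = setOf-valid x W len ∷ stretch-valid (x' ∷ xs) W m len

++-ʳ++-assoc : ∀ (A xs T : Config n) → A ++ (xs ʳ++ T) ≡ (A ++ reverse xs) ++ T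
++-ʳ++-assoc A xs T = trans (cong (A ++_) (ʳ++-defn xs)) (sym (++-assoc A (reverse xs) T))

-- Induction on the remaining requests. Each fetched element joins the front of `A`, so the next one
-- to request always stands just before `W`, at position `ℓ`. After `i` accesses the budgets on `W`
-- are `i * ℓ`; the term `length W * ℓ` is the final group fetch.
dlmRun-stretch : ∀ {c m ℓ i} {A : Config n} x xs {w V B K} Rs → let W = w ∷ V in
  1 ≤ c → c * length W ≤ ℓ → length A + length (x ∷ xs) ≡ ℓ → i + length (x ∷ xs) ≡ suc c →
  Unique (A ++ ((x ∷ xs) ʳ++ W)) → Charged W (i * ℓ) B →
  (∀ B' → (∀ z → B' z ≡ 0) → K ≤ dlmRun c (W ++ ((x ∷ xs) ʳ++ A) , B') Rs) →
  (length (x ∷ xs) + length W) * ℓ + K ≤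
    dlmRun c (A ++ ((x ∷ xs) ʳ++ W) , B) (requests (stretch (x ∷ xs) W m) ++ Rs)
dlmRun-stretch {c = c} {ℓ = ℓ} {i} {A} x [] {w} {V} {B} {K} Rs 1≤c big len count U ch next
  with refl ← trans (sym len) (+-comm (length A) 1)
  with refl ← suc-injective (trans (sym count) (+-comm i 1)) =
  access-fetch 1≤c U ch Rs refl large next
  where
  -- This is request number `c + 1`, so the budgets on `W` reach `(c + 1) * ℓ`; `big` bounds the
  -- contribution of `W` to the length of the list.
  large : c * length (x ∷ A ++ w ∷ V) ≤ c * ℓ + ℓ
  large = begin
    c * length (x ∷ A ++ w ∷ V)      ≡⟨ cong (c *_) (length-++ (x ∷ A)) ⟩
    c * (ℓ + length (w ∷ V))         ≡⟨ *-distribˡ-+ c ℓ _ ⟩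
    c * ℓ + c * length (w ∷ V)       ≤⟨ +-monoʳ-≤ (c * ℓ) big ⟩
    c * ℓ + ℓ                        ∎
    where open ≤-Reasoning
dlmRun-stretch {c = c} {m} {ℓ = ℓ} {i} {A} x (x' ∷ xs) {w} {V} {B} {K} Rs 1≤c big len count U ch next
  rewrite ++-ʳ++-assoc A (x' ∷ xs) (x ∷ w ∷ V) = begin
  (length (x ∷ x' ∷ xs) + length W) * ℓ + K         ≡⟨ +-assoc ℓ _ K ⟩
  ℓ + ((length (x' ∷ xs) + length W) * ℓ + K)       ≡⟨ cong (_+ ((length (x' ∷ xs) + length W) * ℓ + K)) ℓ≡ ⟨
  suc (length P) + ((length (x' ∷ xs) + length W) * ℓ + K)
    ≤⟨ access-quiet 1≤c U ch (requests (stretch (x' ∷ xs) W m) ++ Rs) small step ⟩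
  dlmRun c (P ++ x ∷ W , B) (requests (stretch (x ∷ x' ∷ xs) W m) ++ Rs) ∎
  where
  open ≤-Reasoning
  W = w ∷ V
  P = A ++ reverse (x' ∷ xs)
  ℓ≡ : suc (length P) ≡ ℓ
  ℓ≡ = trans (cong suc (trans (length-++ A) (cong (length A +_) (length-reverse (x' ∷ xs)))))
             (trans (sym (+-suc (length A) _)) len)
  count' : suc i + length (x' ∷ xs) ≡ suc c
  count' = trans (sym (+-suc i _)) count
  i<c : suc i ≤ c
  i<c = ≤-trans (m≤m+n (suc i) (length xs)) (≤-reflexive (suc-injective (trans (sym (+-suc (suc i) _)) count')))
  -- Before the last request `(i + 1) * ℓ ≤ c * ℓ`; strictness comes from the extra `c ≥ 1` in the
  -- threshold at position `ℓ + 1`.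
  small : i * ℓ + suc (length P) < c * suc (suc (length P))
  small rewrite ℓ≡ | *-suc c ℓ | +-comm (i * ℓ) ℓ = +-mono-≤ 1≤c (*-monoˡ-≤ ℓ i<c)
  step : ∀ B' → Charged W (i * ℓ + suc (length P)) B' →
    (length (x' ∷ xs) + length W) * ℓ + K ≤ dlmRun c (x ∷ P ++ W , B') (requests (stretch (x' ∷ xs) W m) ++ Rs)
  step B' ch' rewrite ℓ≡ | sym (++-ʳ++-assoc (x ∷ A) (x' ∷ xs) W) =
    dlmRun-stretch {i = suc i} {A = x ∷ A} x' xs Rs 1≤c big
      (trans (sym (+-suc (length A) _)) len) count'
      (subst Unique (sym (++-ʳ++-assoc (x ∷ A) (x' ∷ xs) W)) (Unique-shift {P = P} U))
      (subst (λ b → Charged W b B') (+-comm (i * ℓ) ℓ) ch')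
      next

-- The block structure and its rotation from round to round.

-- The length of `W₀ X₁ W₁ … X_k W_k` with `w + 1 = r - 1` elements in each `W_i`. The last pair is
-- the right summand, as in `flatten`.
size : (c w k : ℕ) → ℕ
size c w zero    = suc w
size c w (suc k) = size c w k + (suc c + suc w)

size≡ : ∀ c w k → size c w k ≡ suc w + k * (suc c + suc w)
size≡ c w zero    = sym (+-identityʳ (suc w))
size≡ c w (suc k) = trans (cong (_+ s) (size≡ c w k))
  (trans (+-assoc (suc w) (k * s) s) (cong (suc w +_) (+-comm (k * s) s)))
  where s = suc c + suc w

module Blocks (n c w : ℕ) where

  Block : Set
  Block = Vec (Fin n) (suc c) × Vec (Fin n) (suc w)

  -- The list W₀ X₁ W₁ … X_k W_k.  The pairs (X_i , W_i) are stored last block first, and each X_i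
  -- is stored reversed, so that both are in the order in which they are requested.
  flatten : ∀ {k} → Vec (Fin n) (suc w) → Vec Block k → Config n
  flatten v []              = toList v
  flatten v ((xs , u) ∷ bs) = flatten v bs ++ (toList xs ʳ++ toList u)

  -- The front of the offline list: the representative of the block requested next comes first.
  heads : ∀ {k} → Vec (Fin n) (suc w) → Vec Block k → Config n
  heads v []             = head v ∷ []
  heads v ((_ , u) ∷ bs) = head u ∷ heads v bs

  -- After a round the requested block `u` is the new `W₀`, while the old `W₀` is paired with the
  -- `X` just used.
  plan : ∀ {k} → ℕ → Vec (Fin n) (suc w) → Vec Block (suc k) → Plan n
  plan             zero    _ _               = []
  plan {k = k} (suc N) v ((xs , u) ∷ bs) = stretch (toList xs) (toList u) (suc k) ++ plan N u (bs ∷ʳ (xs , v))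

  -- The right-hand side is the list in which DLM ends a round, so a round acts as a rotation of the
  -- blocks.
  flatten-∷ʳ : ∀ {k} u xs v (bs : Vec Block k) →
    flatten u (bs ∷ʳ (xs , v)) ≡ toList u ++ (toList xs ʳ++ flatten v bs)
  flatten-∷ʳ u xs v []              = refl
  flatten-∷ʳ u xs v ((ys , t) ∷ bs) = begin
    flatten u (bs ∷ʳ (xs , v)) ++ Y             ≡⟨ cong (_++ Y) (flatten-∷ʳ u xs v bs) ⟩
    (U ++ (toList xs ʳ++ F)) ++ Y               ≡⟨ cong (_++ Y) (++-ʳ++-assoc U (toList xs) F) ⟩
    ((U ++ reverse (toList xs)) ++ F) ++ Y      ≡⟨ ++-assoc (U ++ reverse (toList xs)) F Y ⟩
    (U ++ reverse (toList xs)) ++ F ++ Y        ≡⟨ ++-ʳ++-assoc U (toList xs) (F ++ Y) ⟨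
    U ++ (toList xs ʳ++ (F ++ Y))               ∎
    where
    open ≡-Reasoning
    U = toList u
    F = flatten v bs
    Y = toList ys ʳ++ toList t

  flatten-↭ : ∀ {k} u xs v (bs : Vec Block k) → flatten v ((xs , u) ∷ bs) ↭ flatten u (bs ∷ʳ (xs , v))
  flatten-↭ u xs v bs rewrite flatten-∷ʳ u xs v bs = begin
    F ++ (X ʳ++ U)   ↭⟨ ++⁺ˡ F (++↭ʳ++ X U) ⟨
    F ++ X ++ U      ↭⟨ ++-comm F (X ++ U) ⟩
    (X ++ U) ++ F    ↭⟨ ++⁺ʳ F (++-comm X U) ⟩
    (U ++ X) ++ F    ≡⟨ ++-assoc U X F ⟩
    U ++ X ++ F      ↭⟨ ++⁺ˡ U (++↭ʳ++ X F) ⟩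
    U ++ (X ʳ++ F)   ∎
    where
    open Perm.PermutationReasoning
    U = toList u
    X = toList xs
    F = flatten v bs

  heads-∷ʳ : ∀ {k} u xs v (bs : Vec Block k) → heads u (bs ∷ʳ (xs , v)) ≡ heads v bs ++ [ head u ]
  heads-∷ʳ u xs v []             = refl
  heads-∷ʳ u xs v ((_ , t) ∷ bs) = cong (head t ∷_) (heads-∷ʳ u xs v bs)

  flatten-head : ∀ {k} v (bs : Vec Block k) → ∃ λ T → flatten v bs ≡ head v ∷ T
  flatten-head (y ∷ v) []              = toList v , refl
  flatten-head v       ((xs , u) ∷ bs) with T , eq ← flatten-head v bs =
    T ++ (toList xs ʳ++ toList u) , cong (_++ (toList xs ʳ++ toList u)) eq

  length-heads : ∀ {k} v (bs : Vec Block k) → length (heads v bs) ≡ suc k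
  length-heads v []       = refl
  length-heads v (_ ∷ bs) = cong suc (length-heads v bs)

  head-∈ : ∀ (u : Vec (Fin n) (suc w)) → head u ∈ toList u
  head-∈ (_ ∷ _) = here refl

  heads-⊆ : ∀ {k} v (bs : Vec Block k) → ∃ λ T → flatten v bs ↭ heads v bs ++ T
  heads-⊆ (y ∷ v) [] = toList v , ↭-refl
  heads-⊆ v ((xs , y ∷ u) ∷ bs) with T , p ← heads-⊆ v bs = T ++ X ++ toList u , (begin
    flatten v bs ++ (X ʳ++ y ∷ toList u)   ↭⟨ ++⁺ p (↭-sym (++↭ʳ++ X (y ∷ toList u))) ⟩
    (H ++ T) ++ X ++ y ∷ toList u          ↭⟨ ++⁺ˡ (H ++ T) (shift y X (toList u)) ⟩
    (H ++ T) ++ y ∷ X ++ toList u          ↭⟨ shift y (H ++ T) (X ++ toList u) ⟩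
    y ∷ (H ++ T) ++ X ++ toList u          ≡⟨ cong (y ∷_) (++-assoc H T _) ⟩
    y ∷ H ++ T ++ X ++ toList u            ∎)
    where
    open Perm.PermutationReasoning
    X = toList xs
    H = heads v bs

  length-flatten : ∀ {k} v (bs : Vec Block k) → length (flatten v bs) ≡ size c w k
  length-flatten v []              = length-toList v
  length-flatten v ((xs , u) ∷ bs) = trans (length-++ (flatten v bs))
    (cong₂ _+_ (length-flatten v bs)
      (trans (length-ʳ++ (toList xs)) (cong₂ _+_ (length-toList xs) (length-toList u))))

  blocks : ∀ k (xs : Vec (Fin n) (size c w k)) → ∃₂ λ v (bs : Vec Block k) → flatten v bs ↭ toList xs
  blocks zero    v  = v , [] , ↭-refl
  blocks (suc k) zs
    with as , bs , refl ← splitAt (size c w k) zs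
    with xs , u , refl ← splitAt (suc c) bs
    with v , ps , p ← blocks k as
    rewrite toList-++ as (xs Vec.++ u) | toList-++ xs u =
    v , (xs , u) ∷ ps , ++⁺ p (↭-sym (++↭ʳ++ (toList xs) (toList u)))

  planCost-plan : ∀ {k} N v (bs : Vec Block (suc k)) T →
    planCost (heads v bs ++ T) (plan N v bs) ≡ N * (suc c + suc k)
  planCost-plan zero v bs T = refl
  planCost-plan {k} (suc N) v ((x ∷ xs , u) ∷ bs) T = trans
    (planCost-stretch x (toList xs) (suc k) (heads v bs ++ T) _ (head-∈ u))
    (cong₂ _+_ (cong (λ j → suc j + suc k) (length-toList xs))
      (trans (cong (λ π → planCost π (plan N u bs')) rotated) (planCost-plan N u bs' T)))
    where
    bs' = bs ∷ʳ (x ∷ xs , v)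
    -- The block just requested will be needed last, so its representative sinks behind all the
    -- others.
    rotated : applySwaps (sink (suc k)) (head u ∷ heads v bs ++ T) ≡ heads u bs' ++ T
    rotated = begin
      applySwaps (sink (suc k)) (head u ∷ heads v bs ++ T)
        ≡⟨ cong (λ m → applySwaps (sink m) (head u ∷ heads v bs ++ T)) (length-heads v bs) ⟨
      applySwaps (sink (length (heads v bs))) (head u ∷ heads v bs ++ T)
        ≡⟨ applySwaps-sink (head u) (heads v bs) T ⟩
      heads v bs ++ head u ∷ T          ≡⟨ ++-assoc (heads v bs) [ head u ] T ⟨
      (heads v bs ++ [ head u ]) ++ T   ≡⟨ cong (_++ T) (heads-∷ʳ u (x ∷ xs) v bs) ⟨
      heads u bs' ++ T                  ∎
      where open ≡-Reasoning

  plan-valid : ∀ {k} N v (bs : Vec Block (suc k)) → All (ValidRequest (suc (suc w)) ∘ proj₁) (plan N v bs)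
  plan-valid zero    v bs              = []
  plan-valid {k} (suc N) v ((xs , u) ∷ bs) = All.++⁺
    (stretch-valid (toList xs) (toList u) (suc k) (s≤s (≤-reflexive (length-toList u))))
    (plan-valid N u (bs ∷ʳ (xs , v)))

  dlmRun-plan : ∀ {k} → suc k ≡ c → ∀ N v (bs : Vec Block (suc k)) {B} →
    Unique (flatten v bs) → (∀ z → B z ≡ 0) →
    N * ((suc c + suc w) * (c * (suc c + suc w))) ≤ dlmRun c (flatten v bs , B) (requests (plan N v bs))
  dlmRun-plan k≡ zero v bs U B≡0 = z≤n
  dlmRun-plan {k} refl (suc N) v ((x ∷ xs , u@(y ∷ u')) ∷ bs) {B} U B≡0
    rewrite map-++ proj₁ (stretch (x ∷ toList xs) (toList u) (suc k)) (plan N u (bs ∷ʳ (x ∷ xs , v))) = begin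
    s * ℓ + N * (s * ℓ)
      ≡⟨ cong (λ j → j * ℓ + N * (s * ℓ)) (cong₂ _+_ (cong suc (length-toList xs)) (cong suc (length-toList u'))) ⟨
    (length (x ∷ toList xs) + length (toList u)) * ℓ + N * (s * ℓ)
      ≤⟨ dlmRun-stretch {i = 0} x (toList xs) _ (s≤s z≤n) big len (cong suc (length-toList xs)) U
           (zero-charged B≡0) next ⟩
    dlmRun c (flatten v bs ++ (toList (x ∷ xs) ʳ++ toList u) , B)
      (requests (stretch (x ∷ toList xs) (toList u) (suc k)) ++ requests (plan N u (bs ∷ʳ (x ∷ xs , v)))) ∎
    where
    open ≤-Reasoning
    s = suc c + suc w
    ℓ = c * s
    big : c * length (toList u) ≤ ℓ
    big rewrite length-toList u' = *-monoʳ-≤ c (m≤n+m (suc w) (suc c))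
    -- With `c = k + 1` pairs, the last `X` and `W₀` together supply the missing summand `s` next to
    -- the `k` earlier pairs.
    len : length (flatten v bs) + length (x ∷ toList xs) ≡ ℓ
    len = begin-equality
      length (flatten v bs) + length (x ∷ toList xs)
        ≡⟨ cong₂ _+_ (trans (length-flatten v bs) (size≡ c w k)) (cong suc (length-toList xs)) ⟩
      (suc w + k * s) + suc c   ≡⟨ +-comm _ (suc c) ⟩
      suc c + (suc w + k * s)   ≡⟨ +-assoc (suc c) (suc w) (k * s) ⟨
      s + k * s                 ∎
    next : ∀ B' → (∀ z → B' z ≡ 0) → N * (s * ℓ) ≤
      dlmRun c (toList u ++ (toList (x ∷ xs) ʳ++ flatten v bs) , B') (requests (plan N u (bs ∷ʳ (x ∷ xs , v))))
    next B' B'≡0 rewrite sym (flatten-∷ʳ u (x ∷ xs) v bs) =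
      dlmRun-plan refl N u (bs ∷ʳ (x ∷ xs , v))
        (Unique-resp-↭ (flatten-↭ u (x ∷ xs) v bs) U) B'≡0

-- Natural numbers as rationals, and removal of additive constants.

toℚᵘ-toℚ : ∀ a → Q.toℚᵘ (toℚ a) ℚᵘ.≃ mkℚᵘ (ℤ.+ a) 0
toℚᵘ-toℚ a = Q.toℚᵘ-fromℚᵘ (mkℚᵘ (ℤ.+ a) 0)

toℚ-+ : ∀ a b → toℚ (a + b) ≡ toℚ a Q.+ toℚ b
toℚ-+ a b = Q.toℚᵘ-injective (begin
  Q.toℚᵘ (toℚ (a + b))                   ≈⟨ toℚᵘ-toℚ (a + b) ⟩
  mkℚᵘ (ℤ.+ (a + b)) 0                   ≈⟨ *≡* (cong (ℤ._* ℤ.+ 1)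
    (cong₂ ℤ._+_ (sym (ℤ.*-identityʳ (ℤ.+ a))) (sym (ℤ.*-identityʳ (ℤ.+ b))))) ⟩
  mkℚᵘ (ℤ.+ a) 0 ℚᵘ.+ mkℚᵘ (ℤ.+ b) 0     ≈⟨ ℚᵘ.+-cong (toℚᵘ-toℚ a) (toℚᵘ-toℚ b) ⟨
  Q.toℚᵘ (toℚ a) ℚᵘ.+ Q.toℚᵘ (toℚ b)     ≈⟨ Q.toℚᵘ-homo-+ (toℚ a) (toℚ b) ⟨
  Q.toℚᵘ (toℚ a Q.+ toℚ b)               ∎)
  where open ℚᵘ.≃-Reasoning

toℚ-* : ∀ a b → toℚ (a * b) ≡ toℚ a Q.* toℚ b
toℚ-* a b = Q.toℚᵘ-injective (begin
  Q.toℚᵘ (toℚ (a * b))                   ≈⟨ toℚᵘ-toℚ (a * b) ⟩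
  mkℚᵘ (ℤ.+ (a * b)) 0                   ≈⟨ *≡* (cong (ℤ._* ℤ.+ 1) (ℤ.pos-* a b)) ⟩
  mkℚᵘ (ℤ.+ a) 0 ℚᵘ.* mkℚᵘ (ℤ.+ b) 0     ≈⟨ ℚᵘ.*-cong (toℚᵘ-toℚ a) (toℚᵘ-toℚ b) ⟨
  Q.toℚᵘ (toℚ a) ℚᵘ.* Q.toℚᵘ (toℚ b)     ≈⟨ Q.toℚᵘ-homo-* (toℚ a) (toℚ b) ⟨
  Q.toℚᵘ (toℚ a Q.* toℚ b)               ∎)
  where open ℚᵘ.≃-Reasoning

toℚ-mono : ∀ {a b} → a ≤ b → toℚ a Q.≤ toℚ b
toℚ-mono {a} {b} a≤b = Q.toℚᵘ-cancel-≤ (begin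
  Q.toℚᵘ (toℚ a)    ≃⟨ toℚᵘ-toℚ a ⟩
  mkℚᵘ (ℤ.+ a) 0    ≤⟨ *≤* (ℤ.*-monoʳ-≤-nonNeg (ℤ.+ 1) (+≤+ a≤b)) ⟩
  mkℚᵘ (ℤ.+ b) 0    ≃⟨ toℚᵘ-toℚ b ⟨
  Q.toℚᵘ (toℚ b)    ∎)
  where open ℚᵘ.≤-Reasoning

archimedean : ∀ q → ∃ λ N → q Q.< toℚ N
archimedean q@record{} = N , Q.toℚᵘ-cancel-< (begin-strict
  Q.toℚᵘ q          <⟨ *<* numerator< ⟩
  mkℚᵘ (ℤ.+ N) 0    ≃⟨ toℚᵘ-toℚ N ⟨
  Q.toℚᵘ (toℚ N)    ∎)
  where
  open ℚᵘ.≤-Reasoning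
  N = suc ℤ.∣ Q.↥ q ∣
  numerator< : Q.↥ q ℤ.* ℤ.+ 1 ℤ.< ℤ.+ N ℤ.* Q.↧ q
  numerator< = ℤ.<-≤-trans
    (subst (ℤ._< ℤ.+ N) (sym (ℤ.*-identityʳ (Q.↥ q))) (ℤ.≤-<-trans (i≤∣i∣ (Q.↥ q)) (+<+ ≤-refl)))
    (subst (ℤ.+ N ℤ.≤_) (ℤ.pos-* N (suc (Q.ℚ.denominator-1 q))) (+≤+ (m≤m*n N (suc (Q.ℚ.denominator-1 q)))))
    where
    i≤∣i∣ : ∀ i → i ℤ.≤ ℤ.+ ℤ.∣ i ∣
    i≤∣i∣ (ℤ.+ i)       = ℤ.≤-refl
    i≤∣i∣ ℤ.-[1+ i ]    = ℤ.-≤+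

bounded-multiples : ∀ δ K → (∀ N → toℚ N Q.* δ Q.≤ K) → δ Q.≤ 0ℚ
bounded-multiples δ K bound = Q.≮⇒≥ λ 0<δ → absurd {{positive 0<δ}}
  where
  absurd : {{_ : Positive δ}} → _
  absurd with N , lt ← archimedean (K Q.* (Q.1/ δ) {{Q.pos⇒nonZero δ}}) =
    Q.<-irrefl refl (begin-strict
      K                                                    ≡⟨ Q.*-identityʳ K ⟨
      K Q.* 1ℚ                                             ≡⟨ cong (K Q.*_) (Q.*-inverseˡ δ {{Q.pos⇒nonZero δ}}) ⟨
      K Q.* ((Q.1/ δ) {{Q.pos⇒nonZero δ}} Q.* δ)           ≡⟨ Q.*-assoc K _ δ ⟨
      K Q.* (Q.1/ δ) {{Q.pos⇒nonZero δ}} Q.* δ             <⟨ Q.*-monoˡ-<-pos δ lt ⟩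
      toℚ N Q.* δ                                          ≤⟨ bound N ⟩
      K                                                    ∎)
    where open Q.≤-Reasoning

-- All multiples `N (D - ρE)` stay below the fixed number `ρC + ξ`, so by the Archimedean property
-- `D - ρE` cannot be positive.
linear-≤ : ∀ ρ D E C ξ → (∀ N → toℚ (N * D) Q.≤ ρ Q.* toℚ (C + N * E) Q.+ toℚ ξ) →
  toℚ D Q.≤ ρ Q.* toℚ E
linear-≤ ρ D E C ξ bound = subst₂ Q._≤_ (cancel d e) (Q.+-identityˡ e)
  (Q.+-monoˡ-≤ e (bounded-multiples (d Q.- e) K λ N → begin
    toℚ N Q.* (d Q.- e)
      ≡⟨ expand (toℚ N) d e ⟩
    toℚ N Q.* d Q.- toℚ N Q.* e
      ≡⟨ cong (Q._- toℚ N Q.* e) (toℚ-* N D) ⟨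
    toℚ (N * D) Q.- toℚ N Q.* e
      ≤⟨ Q.+-monoˡ-≤ _ (bound N) ⟩
    ρ Q.* toℚ (C + N * E) Q.+ toℚ ξ Q.- toℚ N Q.* e
      ≡⟨ cong (λ z → ρ Q.* z Q.+ toℚ ξ Q.- toℚ N Q.* e)
           (trans (toℚ-+ C (N * E)) (cong (toℚ C Q.+_) (toℚ-* N E))) ⟩
    ρ Q.* (toℚ C Q.+ toℚ N Q.* toℚ E) Q.+ toℚ ξ Q.- toℚ N Q.* e
      ≡⟨ collect ρ (toℚ C) (toℚ N) (toℚ E) (toℚ ξ) ⟩
    K ∎))
  where
  open Q.≤-Reasoning
  open +-*-Solver
  d = toℚ D
  e = ρ Q.* toℚ E
  K = ρ Q.* toℚ C Q.+ toℚ ξ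
  cancel : ∀ a b → a Q.- b Q.+ b ≡ a
  cancel = solve 2 (λ a b → a :- b :+ b := a) refl
  expand : ∀ x a b → x Q.* (a Q.- b) ≡ x Q.* a Q.- x Q.* b
  expand = solve 3 (λ x a b → x :* (a :- b) := x :* a :- x :* b) refl
  collect : ∀ p k x e z → p Q.* (k Q.+ x Q.* e) Q.+ z Q.- x Q.* (p Q.* e) ≡ p Q.* k Q.+ z
  collect = solve 5 (λ p k x e z → p :* (k :+ x :* e) :+ z :- x :* (p :* e) := p :* k :+ z) refl

-- Families of inputs and the resulting bounds on the ratio.

-- C is the one-time offline cost of the initial rearrangement, D and E are the costs per round.
record LowerBound (n c r C D E : ℕ) : Set where
  field
    π₀          : Config n
    permutation : IsPermutation π₀
    inputs      : ℕ → Plan n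
    valid       : ∀ N → All (ValidRequest r ∘ proj₁) (inputs N)
    dlm≥        : ∀ N → N * D ≤ dlmCost c π₀ (requests (inputs N))
    offline≡    : ∀ N → planCost π₀ (inputs N) ≡ C + N * E

-- The universe is fixed before the number of rounds, so one `ξ` serves the whole family of inputs.
lowerBound⇒≤ : ∀ {n c r C D E} ρ → LowerBound n c r C D E → DLMCompetitiveOn n c r ρ →
  toℚ D Q.≤ ρ Q.* toℚ E
lowerBound⇒≤ {C = C} {D} {E} ρ L (ξ , competitive) = linear-≤ ρ D E C ξ λ N →
  subst (λ m → _ Q.≤ ρ Q.* toℚ m Q.+ toℚ ξ)
    (trans (offCostFrom-follow 0 (follow (inputs N)) π₀ (inputs N) λ _ → refl) (offline≡ N))
    (Q.≤-trans (toℚ-mono (dlm≥ N))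
      (competitive π₀ permutation (requests (inputs N)) (All.map⁺ (valid N)) (follow (inputs N))))
  where open LowerBound L

singleton-lowerBound : ∀ {c} → 1 ≤ c → LowerBound 1 c 1 0 1 1
singleton-lowerBound {c} 1≤c = record
  { π₀          = Fin.zero ∷ []
  ; permutation = ↭-refl
  ; inputs      = λ N → replicate N (R , [])
  ; valid       = λ N → All.replicate⁺ N (setOf-valid Fin.zero [] ≤-refl)
  ; dlm≥        = λ N → dlm N λ _ → refl
  ; offline≡    = offline
  }
  where
  R = setOf (Fin.zero {0} ∷ [])
  dlm : ∀ N {B} → (∀ z → B z ≡ 0) → N * 1 ≤ dlmRun c (Fin.zero ∷ [] , B) (requests (replicate N (R , [])))
  dlm zero    B≡0 = z≤n
  dlm (suc N) B≡0 = access-head (requests (replicate N (R , []))) 1≤c refl ([] ∷ []) B≡0 λ _ → dlm N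
  offline : ∀ N → planCost (Fin.zero ∷ []) (replicate N (R , [])) ≡ N * 1
  offline zero    = refl
  offline (suc N) = cong suc (offline N)

toList-tabulate : ∀ {A : Set} {n} (f : Fin n → A) → toList (Vec.tabulate f) ≡ List.tabulate f
toList-tabulate {n = zero}  f = refl
toList-tabulate {n = suc n} f = cong (f Fin.zero ∷_) (toList-tabulate (f ∘ Fin.suc))

blocks-lowerBound : ∀ k w → let c = suc k; s = suc c + suc w in
  ∃₂ λ n C → LowerBound n c (suc (suc w)) C (s * (c * s)) (suc c + c)
blocks-lowerBound k w
  with v , bs , p ← Blocks.blocks (size (suc k) w (suc k)) (suc k) w (suc k) (Vec.allFin _)
  rewrite toList-tabulate {n = size (suc k) w (suc k)} id
  with T , eq ← Blocks.flatten-head _ _ _ v bs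
  with T' , q ← Blocks.heads-⊆ _ _ _ v bs
  with is , arranged ← ↭⇒applySwaps q
  = size (suc k) w (suc k) , 1 + length' is , record
  { π₀          = flatten v bs
  ; permutation = p
  -- The extra request R leaves DLM_c's state unchanged and lets the offline algorithm rearrange its list.
  ; inputs      = λ N → (R , is) ∷ plan N v bs
  ; valid       = λ N → setOf-valid (head v) [] (s≤s z≤n) ∷ plan-valid N v bs
  ; dlm≥        = λ N → ≤-trans (n≤1+n _)
      (access-head (requests (plan N v bs)) (s≤s z≤n) eq U (λ _ → refl) λ _ → dlmRun-plan refl N v bs U)
  ; offline≡    = λ N → cong₂ _+_
      (cong (_+ length' is) (trans (cong (λ π → accessCost π R) eq)
        (accessCost-∷ {T = T} (∈-setOf⁺ {xs = head v ∷ []} (here refl)))))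
      (trans (cong (λ π → planCost π (plan N v bs)) arranged) (planCost-plan N v bs T'))
  }
  where
  open Blocks (size (suc k) w (suc k)) (suc k) w
  R = setOf (head v ∷ [])
  U = Unique-resp-↭ (↭-sym p) (allFin⁺ _)

-- Uses `r ≤ s` and, since `c ≥ 1`, `2c + 1 ≤ 3c`.
D≥r²E/3 : ∀ k w → let c = suc k; s = suc c + suc w in
  suc (suc w) * suc (suc w) * (suc c + c) ≤ 3 * (s * (c * s))
D≥r²E/3 k w = begin
  suc (suc w) * suc (suc w) * (suc c + c)   ≤⟨ *-mono-≤ (*-mono-≤ r≤s r≤s) E≤3c ⟩
  s * s * (3 * c)                           ≡⟨ rearrange s c ⟩
  3 * (s * (c * s))                         ∎
  where
  open ≤-Reasoning
  c = suc k
  s = suc c + suc w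
  r≤s : suc (suc w) ≤ s
  r≤s = s≤s (m≤n+m (suc w) c)
  E≤3c : suc c + c ≤ 3 * c
  E≤3c = ≤-trans (s≤s (≤-reflexive (+-comm c c))) (≤-trans (+-monoˡ-≤ (c + c) (s≤s z≤n)) (≤-reflexive (triple c)))
    where
    triple : ∀ c → c + (c + c) ≡ 3 * c
    triple = solve-∀
  rearrange : ∀ s c → s * s * (3 * c) ≡ 3 * (s * (c * s))
  rearrange = solve-∀

⅓ : ℚ
⅓ = ℤ.+ 1 Q./ 3

ratio-≤ : ∀ r D e ρ → r * r * suc e ≤ 3 * D → toℚ D Q.≤ ρ Q.* toℚ (suc e) → ⅓ Q.* toℚ (r * r) Q.≤ ρ
ratio-≤ r D e ρ r²E≤3D D≤ρE = Q.*-cancelʳ-≤-pos (toℚ (suc e)) {{Q.normalize-pos (suc e) 1}} (begin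
  ⅓ Q.* toℚ (r * r) Q.* toℚ (suc e)      ≡⟨ Q.*-assoc ⅓ (toℚ (r * r)) (toℚ (suc e)) ⟩
  ⅓ Q.* (toℚ (r * r) Q.* toℚ (suc e))    ≡⟨ cong (⅓ Q.*_) (toℚ-* (r * r) (suc e)) ⟨
  ⅓ Q.* toℚ (r * r * suc e)              ≤⟨ Q.*-monoˡ-≤-nonNeg ⅓ (toℚ-mono r²E≤3D) ⟩
  ⅓ Q.* toℚ (3 * D)                      ≡⟨ cong (⅓ Q.*_) (toℚ-* 3 D) ⟩
  -- The product `⅓ Q.* toℚ 3` evaluates to `1ℚ`.
  ⅓ Q.* (toℚ 3 Q.* toℚ D)                ≡⟨ Q.*-assoc ⅓ (toℚ 3) (toℚ D) ⟨
  1ℚ Q.* toℚ D                           ≡⟨ Q.*-identityˡ (toℚ D) ⟩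
  toℚ D                                  ≤⟨ D≤ρE ⟩
  ρ Q.* toℚ (suc e)                      ∎)
  where open Q.≤-Reasoning

theorem14 : Σ ℚ λ κ₀ → (0ℚ Q.< κ₀) ×
    ((c r : ℕ) → 1 ≤ c → 1 ≤ r → (ρ : ℚ) →
    ((n : ℕ) → DLMCompetitiveOn n c r ρ) →
    κ₀ Q.* toℚ (r * r) Q.≤ ρ)
theorem14 = ⅓ , Q.positive⁻¹ ⅓ , bound
  where
  bound : (c r : ℕ) → 1 ≤ c → 1 ≤ r → (ρ : ℚ) → ((n : ℕ) → DLMCompetitiveOn n c r ρ) →
    ⅓ Q.* toℚ (r * r) Q.≤ ρ
  bound (suc k) 1             1≤c _ ρ competitive =
    ratio-≤ 1 1 0 ρ (s≤s z≤n) (lowerBound⇒≤ ρ (singleton-lowerBound 1≤c) (competitive 1))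
  bound (suc k) (suc (suc w)) _   _ ρ competitive =
    let n , C , L = blocks-lowerBound k w
        s = suc (suc k) + suc w
    in ratio-≤ (suc (suc w)) (s * (suc k * s)) (suc k + suc k) ρ (D≥r²E/3 k w) (lowerBound⇒≤ ρ L (competitive n))
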